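{- Let $D$ be a domain and let $\varepsilon\in((D\to\mathcal{B})\to D)^\omega$. If for each $i\in\mathbb{N}$ the functional $\varepsilon_i$ is a selection functional for a set $K_i\subseteq D$, then $\Pi(\varepsilon)$ is a selection functional for the set $\prod_i K_i\subseteq D^\omega$.
   Context: Domains are the objects of a fixed cartesian closed category of effectively given domains (for instance effectively given Scott domains, i.e. algebraic, bounded complete, directed complete posets), containing the flat domains $\mathcal{B}=\{0,1,\bot\}$ of booleans and $\mathcal{N}=\mathbb{N}\cup\{\bot\}$ of natural numbers, and closed under countable powers $D^\omega$. $(D\to E)$ denotes the domain of Scott continuous maps ordered pointwise. A predicate $p\in(D\to\mathcal{B})$ is defined on $K\subseteq D$ if $p(x)\neq\bot$ for all $x\in K$. A selection functional for $K\subseteq D$ is a functional $\varepsilon_K\in((D\to\mathcal{B})\to D)$ such that for every $p\in(D\to\mathcal{B})$ defined on $K$: (i) $\varepsilon_K(p)\in K$, and (ii) $p(\varepsilon_K(p))=1$ if $p(x)=1$ for some $x\in K$. The product functional $$\Pi:((D\to\mathcal{B})\to D)^\omega\to((D^\omega\to\mathcal{B})\to D^\omega)$$ is defined recursively (as a least fixed point; it is computable) by $$\Pi(\varepsilon)(p)(n)=\varepsilon_n\bigl(\lambda x.\,p_{n,x,\varepsilon}(\Pi(\varepsilon^{(n+1)})(p_{n,x,\varepsilon}))\bigr),$$ where $\varepsilon^{(k)}_i=\varepsilon_{k+i}$ and $p_{n,x,\varepsilon}(\alpha)=p(\beta)$ for the sequence $\beta\in D^\omega$ with $\beta_i=\Pi(\varepsilon)(p)(i)$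 if $i<n$, $\beta_n=x$, and $\beta_i=\alpha_{i-n-1}$ if $i>n$. -}

module Defs where

open import Level using (Level; Setω; Lift; lift; _⊔_) renaming (suc to lsuc)
open import Axiom.ExcludedMiddle using (ExcludedMiddle)
open import Data.Bool.Base using (Bool; true)
open import Data.Empty using (⊥-elim)
import Data.Nat.Base as ℕ
open import Data.Nat.Base using (ℕ; zero; suc; _+_; _∸_; _≤_; z≤n; s≤s)
import Data.Nat.Properties as ℕₚ
open import Data.Product using (Σ; ∃; _×_; _,_; proj₁; proj₂)
open import Data.Product.Relation.Binary.Pointwise.NonDependent using (×-poset)
open import Data.Unit.Polymorphic.Base using (⊤; tt)
open import Function.Base using (_∘_)
open import Relation.Binary.Bundles using (Poset)
open import Relation.Binary.Construct.Add.Infimum.NonStrict using (_≤₋_; ⊥₋≤_; [_]; ≤₋-isPartialOrder-≡)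
open import Relation.Binary.Definitions using (tri<; tri≈; tri>; _Respects_)
open import Relation.Binary.PropositionalEquality using (_≡_; refl; sym)
import Relation.Binary.PropositionalEquality as ≡
open import Relation.Nullary using (¬_; yes; no)
open import Relation.Nullary.Construct.Add.Infimum using (_₋; ⊥₋; [_])
open import Relation.Unary using (Pred)

-- The metatheory is classical.  Excluded middle is already needed to see that
-- the flat poset on a set is directed complete.
Classical : Setω
Classical = ∀ {ℓ} → ExcludedMiddle ℓ

------------------------------------------------------------------------
-- Domains

module _ {i : Level} (P : Poset (lsuc i) (lsuc i) (lsuc i)) where
  open Poset P using (Carrier) renaming (_≤_ to _⊑_)

  record IsDirected {I : Set i} (f : I → Carrier) : Set (lsuc i) where
    field
      inhabited : I
      bound     : ∀ j k → ∃ λ l → (f j ⊑ f l) × (f k ⊑ f l)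

  record IsLub {I : Set i} (f : I → Carrier) (s : Carrier) : Set (lsuc i) where
    field
      upper : ∀ j → f j ⊑ s
      least : ∀ u → (∀ j → f j ⊑ u) → s ⊑ u

open IsDirected public
open IsLub public

-- Pointed dcpos.  Equality of elements is the setoid equality of the underlying
-- poset, and directed families are indexed by types in Set i, while carriers
-- and orders live in Set (lsuc i), so that function spaces stay at this level.
record Domain (i : Level) : Set (lsuc (lsuc i)) where
  no-eta-equality
  field
    poset : Poset (lsuc i) (lsuc i) (lsuc i)
  open Poset poset public renaming (_≤_ to _⊑_; refl to ⊑-refl; trans to ⊑-trans)
  field
    ⊥       : Carrier
    ⊥-least : ∀ x → ⊥ ⊑ x
    ⨆       : {I : Set i} (f : I → Carrier) → IsDirected poset f → Carrier
    ⨆-isLub : {I : Set i} (f : I → Carrier) (d : IsDirected poset f) →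
              IsLub poset f (⨆ f d)

private
  variable
    i : Level
    A B E Γ : Domain i

open Domain using (poset; ⊥; ⊥-least; ⨆; ⨆-isLub)

∣_∣ : Domain i → Set (lsuc i)
∣ D ∣ = Domain.Carrier D

module _ (D E : Domain i) where
  private
    module D = Domain D
    module E = Domain E

  infixr 2 _⟶_
  record _⟶_ : Set (lsuc i) where
    no-eta-equality
    infixl 9 _·_
    field
      _·_       : ∣ D ∣ → ∣ E ∣
      mono      : ∀ {x y} → x D.⊑ y → _·_ x E.⊑ _·_ y
      preserves : {I : Set i} (f : I → ∣ D ∣) → IsDirected D.poset f →
                  ∀ {s} → IsLub D.poset f s → IsLub E.poset (_·_ ∘ f) (_·_ s)

open _⟶_ public

private
  image-directed : (h : A ⟶ B) {I : Set _} {f : I → ∣ A ∣} →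
                   IsDirected (Domain.poset A) f →
                   IsDirected (Domain.poset B) ((h ·_) ∘ f)
  image-directed h d .inhabited = d .inhabited
  image-directed h d .bound j k with d .bound j k
  ... | l , p , q = l , mono h p , mono h q

------------------------------------------------------------------------
-- The flat domains

module Flat (em : Classical) (i : Level) (X : Set) where
  Elem : Set (lsuc i)
  Elem = Lift (lsuc i) X ₋

  order : Poset (lsuc i) (lsuc i) (lsuc i)
  order = record { isPartialOrder = ≤₋-isPartialOrder-≡ {A = Lift (lsuc i) X} _≡_ ≡.isPartialOrder }
  open Poset order using () renaming (_≤_ to _⊑_)

  sup : {I : Set i} → (I → Elem) → Elem
  sup {I} f with em {P = Σ I λ j → ∃ λ a → f j ≡ [ a ]}
  ... | yes (_ , a , _) = [ a ]
  ... | no  _           = ⊥₋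

  private
    top : ∀ {a} {c d : Elem} → c ≡ [ a ] → c ⊑ d → d ≡ [ a ]
    top refl [ refl ] = refl

  sup-upper : {I : Set i} (f : I → Elem) → IsDirected order f → ∀ j → f j ⊑ sup f
  sup-upper {I} f d j with em {P = Σ I λ j → ∃ λ a → f j ≡ [ a ]} | f j in eq
  ... | yes _           | ⊥₋    = ⊥₋≤ _
  ... | no  _           | ⊥₋    = ⊥₋≤ _
  ... | no  n           | [ b ] = ⊥-elim (n (j , b , eq))
  ... | yes (k , a , e) | [ b ] with d .bound j k
  ...   | l , p , q with ≡.trans (sym (top eq p)) (top e q)
  ...     | refl = [ refl ]

  sup-least : {I : Set i} (f : I → Elem) → ∀ u → (∀ j → f j ⊑ u) → sup f ⊑ u
  sup-least {I} f u h with em {P = Σ I λ j → ∃ λ a → f j ≡ [ a ]}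
  ... | yes (k , a , e) = ≡.subst (_⊑ u) e (h k)
  ... | no  _           = ⊥₋≤ u

flat : Classical → Set → Domain i
flat {i} em X .poset         = Flat.order em i X
flat {i} em X .⊥             = ⊥₋
flat {i} em X .⊥-least       = ⊥₋≤_
flat {i} em X .⨆ f _         = Flat.sup em i X f
flat {i} em X .⨆-isLub f d   = record
  { upper = Flat.sup-upper em i X f d ; least = Flat.sup-least em i X f }

𝔹 : Classical → Domain i
𝔹 em = flat em Bool

𝟙ᴮ : (em : Classical) → ∣ 𝔹 {i} em ∣
𝟙ᴮ _ = [ lift true ]

𝒩 : Classical → Domain i
𝒩 em = flat em ℕ

------------------------------------------------------------------------
-- Finite products, countable powers and function spaces

𝟏 : Domain i
𝟏 .poset = record
  { Carrier = ⊤ ; _≈_ = λ _ _ → ⊤ ; _≤_ = λ _ _ → ⊤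
  ; isPartialOrder = record
    { isPreorder = record
      { isEquivalence = record { refl = tt ; sym = λ _ → tt ; trans = λ _ _ → tt }
      ; reflexive = λ _ → tt ; trans = λ _ _ → tt }
    ; antisym = λ _ _ → tt } }
𝟏 .⊥           = tt
𝟏 .⊥-least _   = tt
𝟏 .⨆ _ _       = tt
𝟏 .⨆-isLub _ _ = record { upper = λ _ → tt ; least = λ _ _ → tt }

module Product (A B : Domain i) where
  private
    module A = Domain A
    module B = Domain B

  order : Poset (lsuc i) (lsuc i) (lsuc i)
  order = ×-poset A.poset B.poset

  proj₁-directed : ∀ {I : Set i} {f : I → ∣ A ∣ × ∣ B ∣} →
                   IsDirected order f → IsDirected A.poset (proj₁ ∘ f)
  proj₁-directed d .inhabited = d .inhabited
  proj₁-directed d .bound j k with d .bound j k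
  ... | l , p , q = l , proj₁ p , proj₁ q

  proj₂-directed : ∀ {I : Set i} {f : I → ∣ A ∣ × ∣ B ∣} →
                   IsDirected order f → IsDirected B.poset (proj₂ ∘ f)
  proj₂-directed d .inhabited = d .inhabited
  proj₂-directed d .bound j k with d .bound j k
  ... | l , p , q = l , proj₂ p , proj₂ q

infixr 4 _⊗_
_⊗_ : Domain i → Domain i → Domain i
(A ⊗ B) .poset           = Product.order A B
(A ⊗ B) .⊥               = A .⊥ , B .⊥
(A ⊗ B) .⊥-least (x , y) = A .⊥-least x , B .⊥-least y
(A ⊗ B) .⨆ f d           = A .⨆ (proj₁ ∘ f) (Product.proj₁-directed A B d)
                         , B .⨆ (proj₂ ∘ f) (Product.proj₂-directed A B d)
(A ⊗ B) .⨆-isLub f d     = record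
  { upper = λ j → A .⨆-isLub _ _ .upper j , B .⨆-isLub _ _ .upper j
  ; least = λ (u , v) h → A .⨆-isLub _ _ .least u (proj₁ ∘ h)
                        , B .⨆-isLub _ _ .least v (proj₂ ∘ h) }

module Power (D : Domain i) where
  private module D = Domain D

  order : Poset (lsuc i) (lsuc i) (lsuc i)
  order = record
    { Carrier = ℕ → ∣ D ∣
    ; _≈_ = λ x y → ∀ n → x n D.≈ y n
    ; _≤_ = λ x y → ∀ n → x n D.⊑ y n
    ; isPartialOrder = record
      { isPreorder = record
        { isEquivalence = record
          { refl  = λ n → D.Eq.refl
          ; sym   = λ p n → D.Eq.sym (p n)
          ; trans = λ p q n → D.Eq.trans (p n) (q n) }
        ; reflexive = λ p n → D.reflexive (p n)
        ; trans     = λ p q n → D.⊑-trans (p n) (q n) }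
      ; antisym = λ p q n → D.antisym (p n) (q n) } }

  at-directed : ∀ {I : Set i} {f : I → ℕ → ∣ D ∣} → IsDirected order f →
                ∀ n → IsDirected D.poset (λ j → f j n)
  at-directed d n .inhabited = d .inhabited
  at-directed d n .bound j k with d .bound j k
  ... | l , p , q = l , p n , q n

infix 8 _^ω
_^ω : Domain i → Domain i
(D ^ω) .poset         = Power.order D
(D ^ω) .⊥ n           = D .⊥
(D ^ω) .⊥-least x n   = D .⊥-least (x n)
(D ^ω) .⨆ f d n       = D .⨆ (λ j → f j n) (Power.at-directed D d n)
(D ^ω) .⨆-isLub f d   = record
  { upper = λ j n → D .⨆-isLub _ _ .upper j
  ; least = λ u h n → D .⨆-isLub _ _ .least (u n) (λ j → h j n) }

module FunctionSpace (D E : Domain i) where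
  private
    module D = Domain D
    module E = Domain E

  order : Poset (lsuc i) (lsuc i) (lsuc i)
  order = record
    { Carrier = D ⟶ E
    ; _≈_ = λ f g → ∀ x → f · x E.≈ g · x
    ; _≤_ = λ f g → ∀ x → f · x E.⊑ g · x
    ; isPartialOrder = record
      { isPreorder = record
        { isEquivalence = record
          { refl  = λ x → E.Eq.refl
          ; sym   = λ p x → E.Eq.sym (p x)
          ; trans = λ p q x → E.Eq.trans (p x) (q x) }
        ; reflexive = λ p x → E.reflexive (p x)
        ; trans     = λ p q x → E.⊑-trans (p x) (q x) }
      ; antisym = λ p q x → E.antisym (p x) (q x) } }

  at-directed : ∀ {I : Set i} {f : I → D ⟶ E} → IsDirected order f →
                ∀ x → IsDirected E.poset (λ j → f j · x)
  at-directed d x .inhabited = d .inhabited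
  at-directed d x .bound j k with d .bound j k
  ... | l , p , q = l , p x , q x

  bottom : D ⟶ E
  bottom ._·_ _             = E.⊥
  bottom .mono _            = E.⊑-refl
  bottom .preserves f d _   = record
    { upper = λ _ → E.⊑-refl ; least = λ u _ → E.⊥-least u }

  sup : {I : Set i} (f : I → D ⟶ E) → IsDirected order f → D ⟶ E
  sup f d ._·_ x = E.⨆ (λ j → f j · x) (at-directed d x)
  sup f d .mono p = E.⨆-isLub _ _ .least _ λ j →
    E.⊑-trans (mono (f j) p) (E.⨆-isLub _ _ .upper j)
  sup f d .preserves g e {s} l = record
    { upper = λ k → sup f d .mono (l .upper k)
    ; least = λ u h → E.⨆-isLub _ _ .least u λ j →
        preserves (f j) g e l .least u λ k →
          E.⊑-trans (E.⨆-isLub _ (at-directed d (g k)) .upper j) (h k) }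

infixr 3 _⇒_
_⇒_ : Domain i → Domain i → Domain i
(D ⇒ E) .poset         = FunctionSpace.order D E
(D ⇒ E) .⊥             = FunctionSpace.bottom D E
(D ⇒ E) .⊥-least f x   = E .⊥-least (f · x)
(D ⇒ E) .⨆             = FunctionSpace.sup D E
(D ⇒ E) .⨆-isLub f d   = record
  { upper = λ j x → E .⨆-isLub _ (FunctionSpace.at-directed D E d x) .upper j
  ; least = λ u h x → E .⨆-isLub _ _ .least (u · x) (λ j → h j x) }

-- A category of domains (for instance effectively given Scott domains) is a full
-- subcategory of pointed dcpos and Scott continuous maps that is closed under
-- the constructions above.  An element of Obj D may carry data, such as an
-- effective presentation of D.
record DomainCategory (em : Classical) (i ℓ : Level) : Set (lsuc (lsuc i) ⊔ lsuc ℓ) where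
  field
    Obj         : Domain i → Set ℓ
    one         : Obj 𝟏
    product     : ∀ {D E} → Obj D → Obj E → Obj (D ⊗ E)
    exponential : ∀ {D E} → Obj D → Obj E → Obj (D ⇒ E)
    power       : ∀ {D} → Obj D → Obj (D ^ω)
    booleans    : Obj (𝔹 em)
    naturals    : Obj (𝒩 em)

------------------------------------------------------------------------
-- Continuous maps Γ ⟶ A, read as terms of type A in context Γ

idᶜ : Γ ⟶ Γ
idᶜ ._·_ γ            = γ
idᶜ .mono p           = p
idᶜ .preserves _ _ l  = l

weaken : Γ ⟶ B → (Γ ⊗ A) ⟶ B
weaken h ._·_ (γ , _)    = h · γ
weaken h .mono (p , _)   = mono h p
weaken {Γ = Γ} {A = A} h .preserves f d {s , t} l =
  preserves h (proj₁ ∘ f) (Product.proj₁-directed Γ A d) record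
    { upper = λ j → proj₁ (l .upper j)
    ; least = λ u q → proj₁ (l .least (u , t) λ j → q j , proj₂ (l .upper j)) }

var : (Γ ⊗ A) ⟶ A
var ._·_ (_ , a)  = a
var .mono (_ , p) = p
var .preserves f d {s , t} l = record
  { upper = λ j → proj₂ (l .upper j)
  ; least = λ u q → proj₂ (l .least (s , u) λ j → proj₁ (l .upper j) , q j) }

lam : (Γ ⊗ A) ⟶ B → Γ ⟶ (A ⇒ B)
lam t ._·_ γ ._·_ a                    = t · (γ , a)
lam {Γ = Γ} t ._·_ γ .mono p           = mono t (Domain.⊑-refl Γ , p)
lam {Γ = Γ} t ._·_ γ .preserves f d l  = preserves t (λ j → γ , f j)
  (record { inhabited = d .inhabited
          ; bound = λ j k → let (n , p , q) = d .bound j k in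
                            n , (Domain.⊑-refl Γ , p) , (Domain.⊑-refl Γ , q) })
  (record { upper = λ j → Domain.⊑-refl Γ , l .upper j
          ; least = λ (u , v) q → proj₁ (q (d .inhabited)) , l .least v (proj₂ ∘ q) })
lam {A = A} t .mono p a                = mono t (p , Domain.⊑-refl A)
lam {A = A} t .preserves f d l         = record
  { upper = λ j a → mono t (l .upper j , Domain.⊑-refl A)
  ; least = λ u h a → preserves t (λ j → f j , a)
      (record { inhabited = d .inhabited
              ; bound = λ j k → let (n , p , q) = d .bound j k in
                                n , (p , Domain.⊑-refl A) , (q , Domain.⊑-refl A) })
      (record { upper = λ j → l .upper j , Domain.⊑-refl A
              ; least = λ (v , w) q → l .least v (proj₁ ∘ q) , proj₂ (q (d .inhabited)) })
      .least (u · a) (λ j → h j a) }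

infixl 9 _$_
_$_ : Γ ⟶ (A ⇒ B) → Γ ⟶ A → Γ ⟶ B
(t $ a) ._·_ γ = (t · γ) · (a · γ)
_$_ {B = B} t a .mono {x} {y} p =
  Domain.⊑-trans B (mono (t · x) (mono a p)) (mono t p (a · y))
_$_ {A = A} {B = B} t a .preserves f d {s} l = record
  { upper = λ j → (t $ a) .mono (l .upper j)
  ; least = λ u h →
      B.⊑-trans
        (preserves t f d l .least (A⇒B.⨆ _ t-directed) (A⇒B.⨆-isLub _ t-directed .upper) (a · s))
        (B.⨆-isLub _ _ .least u λ j →
          preserves (t · f j) _ (image-directed a d) (preserves a f d l) .least u λ k →
            let (n , p , q) = d .bound j k in
            B.⊑-trans (B.⊑-trans (mono (t · f j) (mono a q)) (mono t p (a · f n))) (h n)) }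
  where
  module B   = Domain B
  module A⇒B = Domain (A ⇒ B)
  t-directed = image-directed t d

tuple : (ℕ → Γ ⟶ A) → Γ ⟶ (A ^ω)
tuple t ._·_ γ n          = t n · γ
tuple t .mono p n         = mono (t n) p
tuple t .preserves f d l  = record
  { upper = λ j n → mono (t n) (l .upper j)
  ; least = λ u h n → preserves (t n) f d l .least (u n) (λ j → h j n) }

infixl 9 _at_
_at_ : Γ ⟶ (A ^ω) → ℕ → Γ ⟶ A
(t at n) ._·_ γ  = (t · γ) n
(t at n) .mono p = mono t p n
_at_ {A = A} t n .preserves f d l = record
  { upper = λ j → mono t (l .upper j) n
  ; least = λ u h → Domain.⊑-trans A
      (preserves t f d l .least _ (Domain.⨆-isLub (A ^ω) _ (image-directed t d) .upper) n)
      (Domain.⨆-isLub A _ _ .least u h) }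

module Fix {D : Domain i} (φ : D ⟶ D) where
  private module D = Domain D

  iterate : ℕ → ∣ D ∣
  iterate zero    = D.⊥
  iterate (suc n) = φ · iterate n

  iterate-mono : ∀ {m n} → m ≤ n → iterate m D.⊑ iterate n
  iterate-mono {n = n} z≤n = D.⊥-least (iterate n)
  iterate-mono (s≤s p)     = mono φ (iterate-mono p)

  chain : Lift i ℕ → ∣ D ∣
  chain (lift n) = iterate n

  chain-directed : IsDirected D.poset chain
  chain-directed .inhabited = lift 0
  chain-directed .bound (lift m) (lift n) =
    lift (m ℕ.⊔ n) , iterate-mono (ℕₚ.m≤m⊔n m n) , iterate-mono (ℕₚ.m≤n⊔m m n)

-- The least fixed point of φ, as the supremum of the iterates of φ at bottom.
fix : {D : Domain i} → D ⟶ D → ∣ D ∣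
fix {D = D} φ = D .⨆ (Fix.chain φ) (Fix.chain-directed φ)

------------------------------------------------------------------------
-- The product functional

-- The sequence equal to β below n, to x at n, and to α shifted by n + 1 above n.
splice : ∀ {a} {X : Set a} → ℕ → (ℕ → X) → X → (ℕ → X) → (ℕ → X)
splice n β x α k with ℕₚ.<-cmp k n
... | tri< _ _ _ = β k
... | tri≈ _ _ _ = x
... | tri> _ _ _ = α (k ∸ n ∸ 1)

module _ (em : Classical) (D : Domain i) where

  Selector : Domain i
  Selector = (D ⇒ 𝔹 em) ⇒ D

  ProductType : Domain i
  ProductType = Selector ^ω ⇒ (D ^ω ⇒ 𝔹 em) ⇒ D ^ω

  -- The map λ π ε p. λ n. εₙ (λ x. p′ (π ε⁽ⁿ⁺¹⁾ p′)), where
  -- p′ = λ α. p (splice n (π ε p) x α) and ε⁽ⁿ⁺¹⁾ is shift n.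
  module ProductStep where
    Γ₁ Γ₂ Γ₃ : Domain i
    Γ₁ = (ProductType ⊗ Selector ^ω) ⊗ (D ^ω ⇒ 𝔹 em)
    Γ₂ = Γ₁ ⊗ D
    Γ₃ = Γ₂ ⊗ D ^ω

    π : Γ₁ ⟶ ProductType
    π = weaken (weaken idᶜ)

    ε : Γ₁ ⟶ Selector ^ω
    ε = weaken var

    p : Γ₁ ⟶ (D ^ω ⇒ 𝔹 em)
    p = var

    x : Γ₂ ⟶ D
    x = var

    α : Γ₃ ⟶ D ^ω
    α = var

    shift : ℕ → Γ₂ ⟶ Selector ^ω
    shift n = tuple λ k → weaken (ε at (n + 1 + k))

    spliced : ℕ → Γ₃ ⟶ D ^ω
    spliced n = tuple (splice n (weaken (weaken (π $ ε $ p)) at_) (weaken x) (α at_))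

    p′ : ℕ → Γ₂ ⟶ (D ^ω ⇒ 𝔹 em)
    p′ n = lam (weaken (weaken p) $ spliced n)

    section : ℕ → Γ₁ ⟶ (D ⇒ 𝔹 em)
    section n = lam (p′ n $ (weaken π $ shift n $ p′ n))

    productStep : ProductType ⟶ ProductType
    productStep = lam (lam (tuple λ n → (ε at n) $ section n))

  Π : Selector ^ω ⟶ ((D ^ω ⇒ 𝔹 em) ⇒ D ^ω)
  Π = fix ProductStep.productStep

------------------------------------------------------------------------
-- Selection functionals

record Subset (D : Domain i) (k : Level) : Set (lsuc i ⊔ lsuc k) where
  field
    Member   : Pred ∣ D ∣ k
    respects : Member Respects (Domain._≈_ D)

open Subset public

infix 4 _∈_
_∈_ : ∀ {k} {D : Domain i} → ∣ D ∣ → Subset D k → Set k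
x ∈ K = Member K x

∏ : ∀ {k} {D : Domain i} → (ℕ → Subset D k) → Subset (D ^ω) k
∏ K .Member α       = ∀ n → α n ∈ K n
∏ K .respects e m n = K n .respects (e n) (m n)

module _ {k : Level} (em : Classical) {D : Domain i} (K : Subset D k) where
  private
    module 𝔹 = Domain (𝔹 {i} em)

  DefinedOn : D ⟶ 𝔹 em → Set (lsuc i ⊔ k)
  DefinedOn p = ∀ x → x ∈ K → ¬ (p · x 𝔹.≈ 𝔹.⊥)

  IsSelectionFunctional : ((D ⇒ 𝔹 em) ⟶ D) → Set (lsuc i ⊔ k)
  IsSelectionFunctional ε = ∀ (p : D ⟶ 𝔹 em) → DefinedOn p →
    (ε · p ∈ K) × ((∃ λ x → (x ∈ K) × (p · x 𝔹.≈ 𝟙ᴮ em)) → p · (ε · p) 𝔹.≈ 𝟙ᴮ em)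

{-# OPTIONS --safe #-}

-- Write x ∷ α for `cons x α` and pₓ for `p after x`, that is λ α. p (x ∷ α).
-- The fixed point equation for Π amounts to Π ε p ≈ x₀ ∷ Π (ε ∘ suc) pₓ₀ with
-- x₀ = ε₀ (λ x. pₓ (Π (ε ∘ suc) pₓ)), so Π ε selects for p as soon as
-- Π (ε ∘ suc) selects for pₓ for every x ∈ K₀.  It also selects for p when p ⊥
-- is defined, since p is then constant.  Finally, if p is defined on ∏ K, these
-- two rules reach p: otherwise dependent choice, which excluded middle for all
-- types provides, yields α ∈ ∏ K such that p is undefined at every truncation
-- of α, hence at α by continuity.
module Submission where

open import Defs
open import Level using (Level; Lift; lift; _⊔_) renaming (suc to lsuc)
open import Data.Empty using (⊥-elim)
import Data.Nat.Base as ℕ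
open import Data.Nat.Base using (ℕ; zero; suc; _+_; _≤_; _<_; z≤n; s≤s)
import Data.Nat.Properties as ℕₚ
open import Data.Nat.Induction using (<-rec)
open import Data.Product using (∃; _×_; _,_; proj₁; proj₂)
open import Function.Base using (_∘_)
open import Relation.Binary.Construct.Add.Infimum.NonStrict using (⊥₋≤_; [_])
open import Relation.Binary.Definitions using (tri<; tri≈; tri>)
open import Relation.Binary.PropositionalEquality using (_≡_; refl; sym; trans; cong; subst)
open import Relation.Nullary using (¬_)
open import Relation.Nullary.Decidable using (decidable-stable)

private
  variable
    i : Level

-- Congruence of application and the fixed point equation.

module _ {A B : Domain i} where
  private
    module A = Domain A
    module B = Domain B

  ·-congʳ : (f : A ⟶ B) → ∀ {x y} → x A.≈ y → (f · x) B.≈ (f · y)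
  ·-congʳ f e = B.antisym (mono f (A.reflexive e)) (mono f (A.reflexive (A.Eq.sym e)))

  ·-cong : {f g : A ⟶ B} → Domain._≈_ (A ⇒ B) f g →
           ∀ {x y} → x A.≈ y → (f · x) B.≈ (g · y)
  ·-cong {g = g} e {x} e′ = B.Eq.trans (e x) (·-congʳ g e′)

fix-fixed : {D : Domain i} (φ : D ⟶ D) → Domain._≈_ D (fix φ) (φ · fix φ)
fix-fixed {D = D} φ = D.antisym
  (lub .least (φ · fix φ) λ where
    (lift zero)    → D.⊥-least _
    (lift (suc n)) → mono φ (lub .upper (lift n)))
  (preserves φ (Fix.chain φ) (Fix.chain-directed φ) lub .least (fix φ)
    λ (lift n) → lub .upper (lift (suc n)))
  where
  module D = Domain D
  lub = D.⨆-isLub (Fix.chain φ) (Fix.chain-directed φ)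

-- Sequences and splicing.

module _ {a} {X : Set a} where

  cons : X → (ℕ → X) → ℕ → X
  cons x α zero    = x
  cons x α (suc n) = α n

  splice-map : ∀ {b} {Y : Set b} (f : X → Y) n β x α k →
               f (splice n β x α k) ≡ splice n (f ∘ β) (f x) (f ∘ α) k
  splice-map f n β x α k with ℕₚ.<-cmp k n
  ... | tri< _ _ _ = refl
  ... | tri≈ _ _ _ = refl
  ... | tri> _ _ _ = refl

  splice-zero : ∀ β x α k → splice 0 β x α k ≡ cons x α k
  splice-zero β x α zero    = refl
  splice-zero β x α (suc k) = refl

  splice-suc : ∀ n β x α k →
               splice (suc n) β x α k ≡ cons (β 0) (splice n (β ∘ suc) x α) k
  splice-suc n β x α zero = refl
  splice-suc n β x α (suc k) with ℕₚ.<-cmp (suc k) (suc n) | ℕₚ.<-cmp k n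
  ... | tri< _ _ _ | tri< _ _ _ = refl
  ... | tri≈ _ _ _ | tri≈ _ _ _ = refl
  ... | tri> _ _ _ | tri> _ _ _ = refl
  ... | tri< l _ _ | tri≈ m _ _ = ⊥-elim (m (ℕ.s<s⁻¹ l))
  ... | tri< l _ _ | tri> m _ _ = ⊥-elim (m (ℕ.s<s⁻¹ l))
  ... | tri≈ m _ _ | tri< l _ _ = ⊥-elim (m (s≤s l))
  ... | tri≈ _ _ l | tri> _ _ m = ⊥-elim (l (s≤s m))
  ... | tri> m _ _ | tri< l _ _ = ⊥-elim (m (s≤s l))
  ... | tri> _ _ l | tri≈ _ _ m = ⊥-elim (m (ℕ.s<s⁻¹ l))

-- Finite approximations of sequences.

module _ (D : Domain i) where
  private
    module D  = Domain D
    module Dω = Domain (D ^ω)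

  -- Agreement below `n` is exactly what the course-of-values induction in `Π-suc` supplies.
  splice-cong : ∀ n {β β′ x α} → (∀ k → k < n → β k D.≈ β′ k) →
                splice n β x α Dω.≈ splice n β′ x α
  splice-cong n h k with ℕₚ.<-cmp k n
  ... | tri< l _ _ = h k l
  ... | tri≈ _ _ _ = D.Eq.refl
  ... | tri> _ _ _ = D.Eq.refl

  cons-cong : ∀ {x y α β} → x D.≈ y → α Dω.≈ β → cons x α Dω.≈ cons y β
  cons-cong e e′ zero    = e
  cons-cong e e′ (suc n) = e′ n

  -- Recursion through `cons` rather than a comparison of indices lets `_after_` peel off one entry
  -- at a time.
  truncate : ℕ → ∣ D ^ω ∣ → ∣ D ^ω ∣
  truncate zero    α = Dω.⊥
  truncate (suc n) α = cons (α 0) (truncate n (α ∘ suc))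

  truncate-mono : ∀ {m n} α → m ≤ n → truncate m α Dω.⊑ truncate n α
  truncate-mono α z≤n k           = D.⊥-least _
  truncate-mono α (s≤s p) zero    = D.⊑-refl
  truncate-mono α (s≤s p) (suc k) = truncate-mono (α ∘ suc) p k

  truncate-⊑ : ∀ n α → truncate n α Dω.⊑ α
  truncate-⊑ zero    α k       = D.⊥-least _
  truncate-⊑ (suc n) α zero    = D.⊑-refl
  truncate-⊑ (suc n) α (suc k) = truncate-⊑ n (α ∘ suc) k

  truncate-at : ∀ n α → truncate (suc n) α n ≡ α n
  truncate-at zero    α = refl
  truncate-at (suc n) α = truncate-at n (α ∘ suc)

  truncations : ∣ D ^ω ∣ → Lift i ℕ → ∣ D ^ω ∣
  truncations α (lift n) = truncate n α

  truncations-directed : ∀ α → IsDirected Dω.poset (truncations α)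
  truncations-directed α .inhabited = lift 0
  truncations-directed α .bound (lift m) (lift n) = lift (m ℕ.⊔ n) ,
    truncate-mono α (ℕₚ.m≤m⊔n m n) , truncate-mono α (ℕₚ.m≤n⊔m m n)

  truncations-isLub : ∀ α → IsLub Dω.poset (truncations α) α
  truncations-isLub α .upper (lift n) = truncate-⊑ n α
  truncations-isLub α .least u h n    =
    subst (D._⊑ u n) (truncate-at n α) (h (lift (suc n)) n)

module _ (em : Classical) {D : Domain i} where
  private
    module D  = Domain D
    module Dω = Domain (D ^ω)
    module 𝔹  = Domain (𝔹 {i} em)
    module P  = Domain (D ^ω ⇒ 𝔹 em)

    Predicate : Set (lsuc i)
    Predicate = D ^ω ⟶ 𝔹 em

    afterᶜ : ((D ^ω ⇒ 𝔹 em) ⊗ D) ⟶ (D ^ω ⇒ 𝔹 em)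
    afterᶜ = lam (weaken (weaken idᶜ) $ tuple (cons (weaken var) (var at_)))

  infixl 10 _after_
  _after_ : Predicate → ∣ D ∣ → Predicate
  p after x = afterᶜ · (p , x)

  -- The two sequences agree only index by index; `p` respects this, and equality in a flat domain
  -- is propositional.
  after-· : ∀ p x α → p after x · α ≡ p · cons x α
  after-· p x α = ·-congʳ p λ where
    zero    → D.Eq.refl
    (suc n) → D.Eq.refl

  defined-maximal : ∀ {u v} → u 𝔹.⊑ v → ¬ (u ≡ 𝔹.⊥) → v ≡ u
  defined-maximal (⊥₋≤ _)  d = ⊥-elim (d refl)
  defined-maximal [ refl ] d = refl

  ⊥-defined-const : ∀ (p : Predicate) → ¬ (p · Dω.⊥ ≡ 𝔹.⊥) → ∀ α → p · α ≡ p · Dω.⊥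
  ⊥-defined-const p d α = defined-maximal (mono p (Dω.⊥-least α)) d

  -- Unfolding the recursion for `Π`.

  module _ (ε : ∣ Selector em D ^ω ∣) (p : Predicate) where
    private
      module S = ProductStep em D

      γ : ∣ S.Γ₁ ∣
      γ = (Π em D , ε) , p

    -- The predicate written p with indices n, x, ε in the recursive definition of the product.
    residual : ℕ → ∣ D ∣ → Predicate
    residual n x = S.p′ n · (γ , x)

    section : ℕ → D ⟶ 𝔹 em
    section n = S.section n · γ

    Π-unfold : ∀ n → (Π em D · ε · p) n D.≈ ε n · section n
    Π-unfold n = fix-fixed S.productStep ε p n

    -- The term splices continuous maps before evaluating them; `splice-map` exchanges the two.
    residual-· : ∀ n x α → residual n x · α ≡ p · splice n (Π em D · ε · p) x α
    residual-· n x α = ·-congʳ p λ k →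
      D.Eq.reflexive
      (splice-map {X = S.Γ₃ ⟶ D} (_· ((γ , x) , α)) n
        (weaken (weaken (S.π $ S.ε $ S.p)) at_) (weaken S.x) (S.α at_) k)

    residual-zero : ∀ x → residual 0 x P.≈ p after x
    residual-zero x α = trans (residual-· 0 x α) (trans
      (·-congʳ p λ k → D.Eq.reflexive (splice-zero _ x α k))
      (sym (after-· p x α)))

    section-zero : ∀ x → section 0 · x ≡ p after x · (Π em D · (ε ∘ suc) · (p after x))
    section-zero x = ·-cong {f = residual 0 x} {p after x} (residual-zero x)
      (·-congʳ (Π em D · (ε ∘ suc)) {residual 0 x} {p after x} (residual-zero x))

  module _ (ε : ∣ Selector em D ^ω ∣) (p : Predicate) where
    private
      β = Π em D · ε · p
      r = p after (β 0)
      β′ = Π em D · (ε ∘ suc) · r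

    residual-suc : ∀ n x → (∀ k → k < n → β (suc k) D.≈ β′ k) →
                   residual ε p (suc n) x P.≈ residual (ε ∘ suc) r n x
    residual-suc n x h α = trans (residual-· ε p (suc n) x α) (trans
      (·-congʳ p (Dω.Eq.trans {_} {cons (β 0) (splice n (β ∘ suc) x α)}
        (λ k → D.Eq.reflexive (splice-suc n β x α k))
        (cons-cong D D.Eq.refl (splice-cong D n h))))
      (sym (trans (residual-· (ε ∘ suc) r n x α) (after-· p (β 0) _))))

    -- Earlier coordinates enter coordinate `suc n` only through the residual, so strong induction
    -- applies.
    Π-suc : ∀ n → β (suc n) D.≈ β′ n
    Π-suc = <-rec _ λ n h → D.Eq.trans (Π-unfold ε p (suc n)) (D.Eq.trans
      (·-congʳ (ε (suc n)) {section ε p (suc n)} {section (ε ∘ suc) r n} λ x →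
        let e = residual-suc n x (λ k l → h l) in
        ·-cong {f = residual ε p (suc n) x} {residual (ε ∘ suc) r n x} e
          -- Shifting `ε ∘ suc` by `n + 1` gives this same sequence by computation, so only the
          -- residuals differ.
          (·-congʳ (Π em D · (λ k → ε (suc n + 1 + k))) {residual ε p (suc n) x} {residual (ε ∘ suc) r n x} e))
      (D.Eq.sym (Π-unfold (ε ∘ suc) r n)))

    Π-cons : β Dω.≈ cons (β 0) β′
    Π-cons zero    = D.Eq.refl
    Π-cons (suc n) = Π-suc n

  -- Well-founded securing and induction along it.

  module _ {k : Level} where

    data Secured (K : ℕ → Subset D k) (p : Predicate) : Set (lsuc i ⊔ k) where
      now   : ¬ (p · Dω.⊥ ≡ 𝔹.⊥) → Secured K p
      later : (∀ x → x ∈ K 0 → Secured (K ∘ suc) (p after x)) → Secured K p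

    -- Excluded middle is applied to the existential type itself, so it yields an actual point for
    -- `escape` to iterate on.
    unsecured-after : ∀ {K p} → ¬ Secured K p →
                      ∃ λ x → (x ∈ K 0) × ¬ Secured (K ∘ suc) (p after x)
    unsecured-after ¬s = decidable-stable em λ ¬e →
      ¬s (later λ x m → decidable-stable em λ ¬s′ → ¬e (x , m , ¬s′))

    escape : ∀ {K p} → ¬ Secured K p → ∣ D ^ω ∣
    escape ¬s zero    = proj₁ (unsecured-after ¬s)
    escape ¬s (suc n) = escape (proj₂ (proj₂ (unsecured-after ¬s))) n

    escape-∈ : ∀ {K p} (¬s : ¬ Secured K p) → escape ¬s ∈ ∏ K
    escape-∈ ¬s zero    = proj₁ (proj₂ (unsecured-after ¬s))
    escape-∈ ¬s (suc n) = escape-∈ (proj₂ (proj₂ (unsecured-after ¬s))) n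

    -- Each `_after_` strips the head of the truncation, until only bottom is left and `now` would
    -- apply.
    escape-undefined : ∀ {K p} (¬s : ¬ Secured K p) n →
                       p · truncate D n (escape ¬s) ≡ 𝔹.⊥
    escape-undefined ¬s zero = decidable-stable em (¬s ∘ now)
    escape-undefined {p = p} ¬s (suc n) = trans
      (sym (after-· p _ _))
      (escape-undefined (proj₂ (proj₂ (unsecured-after ¬s))) n)

    defined⇒secured : ∀ K p → DefinedOn em (∏ K) p → Secured K p
    defined⇒secured K p d = decidable-stable em λ ¬s →
      d (escape ¬s) (escape-∈ ¬s) (𝔹.antisym
        (preserves p _ (truncations-directed D _) (truncations-isLub D _) .least 𝔹.⊥
          λ (lift n) → 𝔹.reflexive (escape-undefined ¬s n))
        (𝔹.⊥-least _))

    cons-∈ : ∀ {K : ℕ → Subset D k} {x α} → x ∈ K 0 → α ∈ ∏ (K ∘ suc) → cons x α ∈ ∏ K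
    cons-∈ m ms zero    = m
    cons-∈ m ms (suc n) = ms n

    DefinedOn-after : ∀ {K p x} → DefinedOn em (∏ K) p → x ∈ K 0 →
                      DefinedOn em (∏ (K ∘ suc)) (p after x)
    DefinedOn-after {K} {p} {x} d m α ms e =
      d (cons x α) (cons-∈ {K} m ms) (trans (sym (after-· p x α)) e)

    -- Stated for a single `p`, since the induction is on its securing tree, with `ε` and `K`
    -- shifting along.
    secured⇒selects : ∀ {K p} (ε : ∣ Selector em D ^ω ∣) →
      (∀ n → IsSelectionFunctional em (K n) (ε n)) →
      Secured K p → DefinedOn em (∏ K) p →
      (Π em D · ε · p ∈ ∏ K) ×
      ((∃ λ α → (α ∈ ∏ K) × (p · α ≡ 𝟙ᴮ em)) → p · (Π em D · ε · p) ≡ 𝟙ᴮ em)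
    secured⇒selects {K} {p} ε sel (now d) _ =
      -- Each value of a section is a value of the constant `p`, so every section is defined.
      (λ n → K n .respects (D.Eq.sym (Π-unfold ε p n))
        (proj₁ (sel n (section ε p n) λ x m e →
          d (trans (sym (⊥-defined-const p d _)) e)))) ,
      λ (α , _ , e) → trans (⊥-defined-const p d _) (trans (sym (⊥-defined-const p d α)) e)
    secured⇒selects {K} {p} ε sel (later s) d =
      ∏ K .respects (Dω.Eq.sym {β} (Π-cons ε p)) (cons-∈ {K} β₀∈K₀ (proj₁ (IH β₀∈K₀))) ,
      λ (α , α∈∏K , pα≡1) →
        -- The tail of `α` is a witness for `p after α 0`, so `q` takes the value 1 on `K 0`; hence
        -- also at `β 0`, which `ε 0` selects for `q`.
        let q-α₀ : q · α 0 ≡ 𝟙ᴮ em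
            q-α₀ = trans (section-zero ε p (α 0))
              (proj₂ (IH (α∈∏K 0)) (α ∘ suc , α∈∏K ∘ suc ,
                trans (trans (after-· p _ _) (·-congʳ p (cons-η α))) pα≡1))
        in trans (·-congʳ p (Π-cons ε p)) (trans (sym (after-· p (β 0) _))
             (trans (sym (section-zero ε p (β 0)))
               (trans (·-congʳ q (Π-unfold ε p 0)) (proj₂ q-selected (α 0 , α∈∏K 0 , q-α₀)))))
      where
      β = Π em D · ε · p
      q = section ε p 0

      IH : ∀ {x} → x ∈ K 0 → _
      IH {x} m = secured⇒selects (ε ∘ suc) (sel ∘ suc) (s x m) (DefinedOn-after {K} {p} d m)

      -- `q` at `x` is `p after x` at a point that lies in the remaining product by `IH`, hence
      -- defined.
      q-selected = sel 0 q λ x m e →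
        DefinedOn-after {K} {p} d m _ (proj₁ (IH m)) (trans (sym (section-zero ε p x)) e)

      β₀∈K₀ : β 0 ∈ K 0
      β₀∈K₀ = K 0 .respects (D.Eq.sym (Π-unfold ε p 0)) (proj₁ q-selected)

      cons-η : ∀ α → cons (α 0) (α ∘ suc) Dω.≈ α
      cons-η α zero    = D.Eq.refl
      cons-η α (suc n) = D.Eq.refl

theorem4p6 : {i k ℓ : Level} (em : Classical) (𝒞 : DomainCategory em i ℓ) →
    (D : Domain i) → DomainCategory.Obj 𝒞 D →
    (ε : ∣ Selector em D ^ω ∣) (K : ℕ → Subset D k) →
    (∀ n → IsSelectionFunctional em (K n) (ε n)) →
    IsSelectionFunctional em (∏ K) (Π em D · ε)
theorem4p6 em 𝒞 D _ ε K sel p d =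
  secured⇒selects em ε sel (defined⇒secured em K p d) d
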